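{- Every divisional poset is factorable. That is, if $\mathcal{P}$ is a divisional poset of rank $r$, then there exist positive integers $d_1,\dots,d_r$ with $\chi_{\mathcal{P}}(t)=\prod_{i=1}^r (t-d_i)$.
   Context: All posets are finite, have a unique minimal element $\hat 0$, and are ranked: for every $x$, all maximal chains with greatest element $x$ have the same length $\operatorname{rk}(x)$; $\operatorname{rk}(\mathcal{P}):=\max_x \operatorname{rk}(x)$. With $\mu$ the Möbius function of $\mathcal{P}$, the characteristic polynomial is $\chi_{\mathcal{P}}(t)=\sum_{x\in\mathcal{P}}\mu(\hat0,x)\,t^{\operatorname{rk}(\mathcal{P})-\operatorname{rk}(x)}$. $\mathcal{P}$ is factorable if every root of $\chi_{\mathcal{P}}(t)$ is a positive integer; the multiset of roots is denoted $\exp(\mathcal{P})$ (so $\exp(\{\hat0\})=\emptyset$). Atoms are the elements of rank $1$; $A(\mathcal{P})$ denotes the set of atoms. For $T\subseteq \mathcal{P}$, $\bigvee T$ denotes the set of minimal upper bounds of $T$ (it may be empty or have several elements); $x\vee y:=\bigvee\{x,y\}$. A lattice is geometric if for all $x,y$: $y$ covers $x$ iff there is an atom $a\not\le x$ with $y=x\vee a$. $\mathcal{P}$ is locally geometric if $\mathcal{P}_{\le x}=\{y: y\le x\}$ is a geometric lattice for every $x$. For an atom $a$, put $\mathcal{P}'':=\mathcal{P}_{\ge a}=\{y:y\ge a\}$ (a poset with minimal element $a$ and rank function $\operatorname{rk}-1$). The class of divisional posets is the smallest class of locally geometric posets such that (1) $\{\hat0\}$ is divisional, and (2) $\mathcal{P}$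 is divisional whenever there is an atom $a$ such that $\mathcal{P}_{\ge a}$ is divisional and $\chi_{\mathcal{P}_{\ge a}}(t)$ divides $\chi_{\mathcal{P}}(t)$.
   Formalization: Adds that rk(P_{≥a}) = rk(P) − 1 at each step of the divisional derivation (automatic if all maximal elements have equal rank); without it the claim fails: the Boolean lattice of rank 2 with an extra maximal atom is divisional but has χ = t² − 3t + 1. -}

module Defs where

open import Level using (0ℓ)
open import Data.Integer.Base as ℤ using (ℤ; +_; -_; 0ℤ; 1ℤ)
open import Data.Irrelevant using ([_])
open import Data.List.Base using (List; []; _∷_; _++_; map; filter; length; foldr; replicate)
open import Data.List.Extrema.Nat using (max)
open import Data.List.Membership.Propositional using (_∈_; find; lose)
open import Data.List.Membership.Propositional.Properties
  using (∈-map⁺; ∈-map⁻; ∈-filter⁺; ∈-filter⁻; ∈-++⁺ˡ; ∈-++⁺ʳ; ∈-++⁻)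
open import Data.List.Properties using (length-map; length-++; filter-all; filter-notAll)
open import Data.List.Relation.Binary.Subset.Propositional using (_⊆_)
open import Data.List.Relation.Unary.All as All using (All; []; _∷_)
import Data.List.Relation.Unary.All.Properties as AllP
open import Data.List.Relation.Unary.AllPairs as AllPairs using (AllPairs; []; _∷_)
import Data.List.Relation.Unary.AllPairs.Properties as AllPairsP
open import Data.List.Relation.Unary.Any using (here; there; any?)
open import Data.List.Relation.Unary.Unique.Propositional using (Unique)
import Data.List.Relation.Unary.Unique.Propositional.Properties as UniqueP
open import Data.Nat.Base as ℕ using (ℕ; zero; suc; _∸_)
import Data.Nat.Induction as ℕI
import Data.Nat.Properties as ℕP
open import Data.Product.Base using (∃; _×_; _,_; proj₁; proj₂)
open import Data.Refinement using (Refinement-syntax; value; _,_)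
open import Data.Refinement.Properties using (value-injective)
open import Data.Sum.Base using (_⊎_; inj₁; inj₂)
open import Data.Unit.Base using (⊤)
open import Data.Vec.Base as Vec using (Vec)
open import Function.Base using (_∘_; _on_)
open import Function.Bundles using (_⇔_)
open import Induction.WellFounded using (Acc; acc; WellFounded; module Subrelation)
import Relation.Binary.Construct.NonStrictToStrict as ToStrict
import Relation.Binary.Construct.On as On
open import Relation.Binary.Core using (Rel)
open import Relation.Binary.Lattice.Structures using (IsLattice)
open import Relation.Binary.Structures using (IsDecPartialOrder)
open import Relation.Binary.PropositionalEquality
  using (_≡_; refl; sym; trans; cong; subst; isEquivalence; module ≡-Reasoning)
open import Relation.Nullary using (¬_; Dec; yes; no; contradiction; recompute)
open import Relation.Nullary.Decidable using (_×-dec_)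
open import Relation.Unary using (Pred; Decidable)

------------------------------------------------------------------------
-- Integer polynomials

-- Entry number k of the list is the coefficient of tᵏ; trailing zeros
-- are allowed, so equality of polynomials is _≈ₚ_ and not _≡_.
Poly : Set
Poly = List ℤ

coeff : Poly → ℕ → ℤ
coeff []      k       = 0ℤ
coeff (c ∷ p) zero    = c
coeff (c ∷ p) (suc k) = coeff p k

infix  4 _≈ₚ_ _∣ₚ_
infixl 6 _+ₚ_
infixl 7 _*ₚ_

_≈ₚ_ : Rel Poly 0ℓ
p ≈ₚ q = ∀ k → coeff p k ≡ coeff q k

_+ₚ_ : Poly → Poly → Poly
[]      +ₚ q       = q
(c ∷ p) +ₚ []      = c ∷ p
(c ∷ p) +ₚ (d ∷ q) = (c ℤ.+ d) ∷ (p +ₚ q)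

_*ₚ_ : Poly → Poly → Poly
[]      *ₚ q = []
(c ∷ p) *ₚ q = map (c ℤ.*_) q +ₚ (0ℤ ∷ (p *ₚ q))

-- Divisibility in ℤ[t].  Below, the divisor is always monic, so that
-- divisibility in ℚ[t] or ℂ[t] would be the same condition.
_∣ₚ_ : Rel Poly 0ℓ
p ∣ₚ q = ∃ λ r → q ≈ₚ r *ₚ p

monomial : ℤ → ℕ → Poly
monomial c k = replicate k 0ℤ ++ (c ∷ [])

∏[t-_] : ∀ {n} → Vec ℕ n → Poly
∏[t- ds ] = Vec.foldr′ (λ d p → ((- (+ d)) ∷ 1ℤ ∷ []) *ₚ p) (1ℤ ∷ []) ds

------------------------------------------------------------------------
-- Finite posets

private
  filter-filter : ∀ {A : Set} {P Q : Pred A 0ℓ} (P? : Decidable P) (Q? : Decidable Q) →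
                  (∀ {x} → P x → Q x) →
                  ∀ xs → filter P? (filter Q? xs) ≡ filter P? xs
  filter-filter P? Q? P⇒Q [] = refl
  filter-filter P? Q? P⇒Q (x ∷ xs) with Q? x
  filter-filter P? Q? P⇒Q (x ∷ xs) | yes _ with P? x
  ... | yes _ = cong (x ∷_) (filter-filter P? Q? P⇒Q xs)
  ... | no  _ = filter-filter P? Q? P⇒Q xs
  filter-filter P? Q? P⇒Q (x ∷ xs) | no ¬q with P? x
  ... | yes p = contradiction (P⇒Q p) ¬q
  ... | no  _ = filter-filter P? Q? P⇒Q xs

record FinitePoset : Set₁ where
  infix 4 _≤_
  field
    Carrier           : Set
    _≤_               : Rel Carrier 0ℓ
    isDecPartialOrder : IsDecPartialOrder _≡_ _≤_
    elements          : List Carrier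
    complete          : ∀ x → x ∈ elements
    unique            : Unique elements

  open IsDecPartialOrder isDecPartialOrder public
    using (isPartialOrder; _≟_; _≤?_)
    renaming (refl to ≤-refl; trans to ≤-trans; antisym to ≤-antisym)

  open ToStrict _≡_ _≤_ public using (_<_)

  infix 4 _<?_ _⋖_

  _<?_ : ∀ x y → Dec (x < y)
  _<?_ = ToStrict.<-decidable _≡_ _≤_ _≟_ _≤?_

  _⋖_ : Rel Carrier 0ℓ
  x ⋖ y = x < y × (∀ z → x < z → ¬ (z < y))

  Minimal : Pred Carrier 0ℓ
  Minimal x = ∀ y → y ≤ x → y ≡ x

  -- A chain is listed in decreasing order, so a chain with greatest
  -- element x is a list of the form x ∷ C, and its length is length C.
  IsChain : Pred (List Carrier) 0ℓ
  IsChain = AllPairs (λ x y → y < x)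

  IsMaximalChain : Carrier → Pred (List Carrier) 0ℓ
  IsMaximalChain x C =
    IsChain (x ∷ C) × (∀ D → IsChain (x ∷ D) → C ⊆ D → D ⊆ C)

  <-trans : ∀ {x y z} → x < y → y < z → x < z
  <-trans = ToStrict.<-trans _≡_ _≤_ isPartialOrder

  <-≤-trans : ∀ {x y z} → x < y → y ≤ z → x < z
  <-≤-trans (x≤y , x≢y) y≤z =
    ≤-trans x≤y y≤z , λ { refl → x≢y (≤-antisym x≤y y≤z) }

  ≤-<-trans : ∀ {x y z} → x ≤ y → y < z → x < z
  ≤-<-trans x≤y (y≤z , y≢z) =
    ≤-trans x≤y y≤z , λ { refl → y≢z (≤-antisym y≤z x≤y) }

  <-irrefl : ∀ {x} → ¬ (x < x)
  <-irrefl (_ , x≢x) = x≢x refl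

  ≤⇒≡⊎< : ∀ {x y} → x ≤ y → x ≡ y ⊎ x < y
  ≤⇒≡⊎< {x} {y} x≤y with x ≟ y
  ... | yes x≡y = inj₁ x≡y
  ... | no  x≢y = inj₂ (x≤y , x≢y)

  private
    size↓ : Carrier → ℕ
    size↓ x = length (filter (_≤? x) elements)

    size↓-mono : ∀ {x y} → x < y → size↓ x ℕ.< size↓ y
    size↓-mono {x} {y} (x≤y , x≢y) =
      subst (ℕ._< size↓ y)
        (cong length (filter-filter (_≤? x) (_≤? y) (λ z≤x → ≤-trans z≤x x≤y) elements))
        (filter-notAll (_≤? x) (filter (_≤? y) elements)
          (lose (∈-filter⁺ (_≤? y) (complete y) ≤-refl)
                (λ y≤x → x≢y (≤-antisym x≤y y≤x))))

  <-wellFounded : WellFounded _<_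
  <-wellFounded =
    Subrelation.wellFounded size↓-mono (On.wellFounded size↓ ℕI.<-wellFounded)

  möbius : ∀ x y → Acc _<_ y → ℤ
  möbius x y (acc rs) with x ≟ y
  ... | yes _ = 1ℤ
  ... | no  _ = - foldr ℤ._+_ 0ℤ (map term elements)
    where
    term : Carrier → ℤ
    term z with (x ≤? z) ×-dec (z <? y)
    ... | yes (_ , z<y) = möbius x z (rs z<y)
    ... | no  _         = 0ℤ

  -- μ x x = 1 and μ x y = - ∑ { μ x z ∣ x ≤ z < y } for x ≢ y; in
  -- particular μ x y = 0 when x ≰ y.
  μ : Carrier → Carrier → ℤ
  μ x y = möbius x y (<-wellFounded y)

------------------------------------------------------------------------
-- Restriction of the order to a decidable subset

module _ {A : Set} {Q : Pred A 0ℓ} (Q? : Decidable Q) where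

  holds : (v : [ x ∈ A ∣ Q x ]) → Q (value v)
  holds (x , [ q ]) = recompute (Q? x) q

  restrict : List A → List [ x ∈ A ∣ Q x ]
  restrict []       = []
  restrict (x ∷ xs) with Q? x
  ... | yes q = (x , [ q ]) ∷ restrict xs
  ... | no  _ = restrict xs

  map-value-restrict : ∀ xs → map value (restrict xs) ≡ filter Q? xs
  map-value-restrict []       = refl
  map-value-restrict (x ∷ xs) with Q? x
  ... | yes _ = cong (x ∷_) (map-value-restrict xs)
  ... | no  _ = map-value-restrict xs

  ∈-restrict⁺ : ∀ {xs} v → value v ∈ xs → v ∈ restrict xs
  ∈-restrict⁺ {xs} v v∈xs
    with ∈-map⁻ value (subst (value v ∈_) (sym (map-value-restrict xs))
                        (∈-filter⁺ Q? v∈xs (holds v)))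
  ... | w , w∈ , v≡w = subst (_∈ restrict xs) (sym (value-injective v≡w)) w∈

  ∈-restrict⁻ : ∀ {xs} v → v ∈ restrict xs → value v ∈ xs
  ∈-restrict⁻ {xs} v v∈ =
    proj₁ (∈-filter⁻ Q? {xs = xs} (subst (value v ∈_) (map-value-restrict xs) (∈-map⁺ value v∈)))

module _ (P : FinitePoset) {Q : Pred (FinitePoset.Carrier P) 0ℓ} (Q? : Decidable Q) where
  open FinitePoset P

  Subposet : FinitePoset
  Subposet = record
    { Carrier           = [ x ∈ Carrier ∣ Q x ]
    ; _≤_               = _≤_ on value
    ; isDecPartialOrder = record
      { isPartialOrder = record
        { isPreorder = record
          { isEquivalence = isEquivalence
          ; reflexive     = λ { refl → ≤-refl }
          ; trans         = ≤-trans
          }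
        ; antisym = λ x≤y y≤x → value-injective (≤-antisym x≤y y≤x)
        }
      ; _≟_  = Data.Refinement.Properties._≟_ _≟_
      ; _≤?_ = λ x y → value x ≤? value y
      }
    ; elements = restrict Q? elements
    ; complete = λ v → ∈-restrict⁺ Q? v (complete (value v))
    ; unique   = UniqueP.map⁻ (subst Unique (sym (map-value-restrict Q? elements))
                                 (UniqueP.filter⁺ Q? unique))
    }

------------------------------------------------------------------------
-- Finite ranked posets with a unique minimal element

record RankedPoset : Set₁ where
  field
    finitePoset : FinitePoset
  open FinitePoset finitePoset public

  field
    0̂         : Carrier
    0̂-minimal : Minimal 0̂
    0̂-unique  : ∀ x → Minimal x → x ≡ 0̂
    rk        : Carrier → ℕ
    ranked    : ∀ x C → IsMaximalChain x C → length C ≡ rk x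

  rank : ℕ
  rank = max 0 (map rk elements)

  Atom : Pred Carrier 0ℓ
  Atom a = rk a ≡ 1

  χ : Poly
  χ = foldr _+ₚ_ [] (map (λ x → monomial (μ 0̂ x) (rank ∸ rk x)) elements)

  0̂-minimum : ∀ x → 0̂ ≤ x
  0̂-minimum x = go x (<-wellFounded x)
    where
    go : ∀ x → Acc _<_ x → 0̂ ≤ x
    go x (acc rs) with any? (_<? x) elements
    ... | yes any with find any
    ...   | z , _ , z<x = ≤-trans (go z (rs z<x)) (proj₁ z<x)
    go x (acc rs) | no ¬any =
      subst (_≤ x) (0̂-unique x minimal) ≤-refl
      where
      minimal : Minimal x
      minimal y y≤x with ≤⇒≡⊎< y≤x
      ... | inj₁ y≡x = y≡x
      ... | inj₂ y<x = contradiction (lose (complete y) y<x) ¬any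

  coatom : ∀ {z x} → z < x → ∃ λ w → z ≤ w × w ⋖ x
  coatom {z} {x} z<x = go z z<x (size z) ℕP.≤-refl
    where
    size : Carrier → ℕ
    size z = length (filter (z <?_) elements)

    size-anti : ∀ {y z} → y < z → size z ℕ.< size y
    size-anti {y} {z} y<z =
      subst (ℕ._< size y)
        (cong length (filter-filter (z <?_) (y <?_) (<-trans y<z) elements))
        (filter-notAll (z <?_) (filter (y <?_) elements)
          (lose (∈-filter⁺ (y <?_) (complete z) y<z) <-irrefl))

    go : ∀ z → z < x → ∀ n → size z ℕ.≤ n → ∃ λ w → z ≤ w × w ⋖ x
    go z z<x n size≤n with any? (λ w → (z <? w) ×-dec (w <? x)) elements
    ... | no ¬any =
      z , ≤-refl , z<x , λ w z<w w<x → ¬any (lose (complete w) (z<w , w<x))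
    ... | yes any with find any | n
    ...   | w , _ , z<w , w<x | zero  =
      contradiction (ℕP.<-≤-trans (size-anti z<w) size≤n) λ ()
    ...   | w , _ , z<w , w<x | suc m
      with go w w<x m (ℕ.s≤s⁻¹ (ℕP.<-≤-trans (size-anti z<w) size≤n))
    ...     | v , w≤v , v⋖x = v , ≤-trans (proj₁ z<w) w≤v , v⋖x

  -- Any two members of a chain are comparable.
  comparable : ∀ {C} → IsChain C → ∀ {u v} → u ∈ C → v ∈ C → u ≡ v ⊎ u < v ⊎ v < u
  comparable (_ ∷ _)  (here refl) (here refl) = inj₁ refl
  comparable (<x ∷ _) (here refl) (there v∈)  = inj₂ (inj₂ (All.lookup <x v∈))
  comparable (<x ∷ _) (there u∈)  (here refl) = inj₂ (inj₁ (All.lookup <x u∈))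
  comparable (_ ∷ ch) (there u∈)  (there v∈)  = comparable ch u∈ v∈

  filter-chain : ∀ {Q : Pred Carrier 0ℓ} (Q? : Decidable Q) {x C} →
                 IsChain (x ∷ C) → IsChain (x ∷ filter Q? C)
  filter-chain Q? (<x ∷ ch) = AllP.filter⁺ Q? <x ∷ AllPairsP.filter⁺ Q? ch

  maximalChain : ∀ x → ∃ (IsMaximalChain x)
  maximalChain x = go x (<-wellFounded x)
    where
    go : ∀ x → Acc _<_ x → ∃ (IsMaximalChain x)
    go x (acc rs) with ≤⇒≡⊎< (0̂-minimum x)
    ... | inj₁ refl = [] , [] ∷ [] , λ where
      (d ∷ D) (((d≤0̂ , d≢0̂) ∷ _) ∷ _) _ → contradiction (0̂-minimal d d≤0̂) d≢0̂
      []      _                        _ ()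
    ... | inj₂ 0̂<x with coatom 0̂<x
    ...   | w , _ , w<x , w⋖x with go w (rs w<x)
    ...     | C , w∷C@(C<w ∷ _) , max =
      w ∷ C
      , (w<x ∷ All.map (λ c<w → <-trans c<w w<x) C<w) ∷ w∷C
      , λ D x∷D C⊆D → maximal D x∷D C⊆D
      where
      maximal : ∀ D → IsChain (x ∷ D) → w ∷ C ⊆ D → D ⊆ w ∷ C
      maximal D (D<x ∷ ch) C⊆D {d} d∈D with comparable ch d∈D (C⊆D (here refl))
      ... | inj₁ d≡w        = here d≡w
      ... | inj₂ (inj₂ w<d) = contradiction (All.lookup D<x d∈D) (w⋖x d w<d)
      ... | inj₂ (inj₁ d<w) =
        there (max (filter (_<? w) D)
                   (AllP.all-filter (_<? w) D ∷ AllPairsP.filter⁺ (_<? w) ch)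
                   (λ c∈C → ∈-filter⁺ (_<? w) (C⊆D (there c∈C)) (All.lookup C<w c∈C))
                   (∈-filter⁺ (_<? w) d∈D d<w))

------------------------------------------------------------------------
-- Principal ideals and filters

module _ (P : RankedPoset) where
  open RankedPoset P

  private
    module Restriction {Q : Pred Carrier 0ℓ} (Q? : Decidable Q) where
      S : FinitePoset
      S = Subposet finitePoset Q?

      module S = FinitePoset S

      <⁺ : ∀ {u v} → u S.< v → value u < value v
      <⁺ (u≤v , u≢v) = u≤v , u≢v ∘ value-injective

      <⁻ : ∀ {u v} → value u < value v → u S.< v
      <⁻ (u≤v , u≢v) = u≤v , u≢v ∘ cong value

      chain⁺ : ∀ {C} → S.IsChain C → IsChain (map value C)
      chain⁺ = AllPairsP.map⁺ ∘ AllPairs.map <⁺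

      chain⁻ : ∀ {x} D → IsChain (value x ∷ D) → S.IsChain (x ∷ restrict Q? D)
      chain⁻ D ch =
        AllPairs.map <⁻ (AllPairsP.map⁻
          (subst (λ E → IsChain (_ ∷ E)) (sym (map-value-restrict Q? D))
                 (filter-chain Q? ch)))

      -- Members of a chain that satisfy Q belong to each maximal chain of
      -- the subposet that is contained in it.
      maximal : ∀ {x C} → S.IsMaximalChain x C →
                ∀ D → IsChain (value x ∷ D) → map value C ⊆ D →
                ∀ {d} → d ∈ D → Q d → d ∈ map value C
      maximal (_ , max) D ch C⊆D {d} d∈D q =
        ∈-map⁺ value (max (restrict Q? D) (chain⁻ D ch)
                          (λ {c} c∈C → ∈-restrict⁺ Q? c (C⊆D (∈-map⁺ value c∈C)))
                          (∈-restrict⁺ Q? (d , [ q ]) d∈D))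

  -- P≤ P x is { y ∣ y ≤ x }.
  P≤ : Carrier → RankedPoset
  P≤ x = record
    { finitePoset = S
    ; 0̂           = bot
    ; 0̂-minimal   = λ v v≤0̂ → value-injective (0̂-minimal (value v) v≤0̂)
    ; 0̂-unique    = λ v minimal → sym (minimal bot (0̂-minimum (value v)))
    ; rk          = rk ∘ value
    ; ranked      = λ v C max →
        trans (sym (length-map value C)) (ranked (value v) (map value C) (lift v C max))
    }
    where
    open Restriction (_≤? x)

    bot : S.Carrier
    bot = 0̂ , [ 0̂-minimum x ]

    lift : ∀ v C → S.IsMaximalChain v C → IsMaximalChain (value v) (map value C)
    lift v C max = chain⁺ (proj₁ max) , λ { D ch@(D<v ∷ _) C⊆D d∈D →
      maximal max D ch C⊆D d∈D
        (≤-trans (proj₁ (All.lookup D<v d∈D)) (holds (_≤? x) v)) }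

  -- P≥ P a is { y ∣ a ≤ y }.
  P≥ : Carrier → RankedPoset
  P≥ a = record
    { finitePoset = S
    ; 0̂           = bot
    ; 0̂-minimal   = λ v v≤a → value-injective (≤-antisym v≤a (holds (a ≤?_) v))
    ; 0̂-unique    = λ v minimal → sym (minimal bot (holds (a ≤?_) v))
    ; rk          = λ v → rk (value v) ∸ rk a
    ; ranked      = λ v C max → length-C v C max
    }
    where
    open Restriction (a ≤?_)

    bot : S.Carrier
    bot = a , [ ≤-refl ]

    M : List Carrier
    M = proj₁ (maximalChain a)

    M-chain : IsChain (a ∷ M)
    M-chain = proj₁ (proj₂ (maximalChain a))

    M-max : ∀ D → IsChain (a ∷ D) → M ⊆ D → D ⊆ M
    M-max = proj₂ (proj₂ (maximalChain a))

    a≤ : ∀ v → a ≤ value v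
    a≤ = holds (a ≤?_)

    module _ (v : S.Carrier) (C : List S.Carrier) (max : S.IsMaximalChain v C) where

      v∷C : S.IsChain (v ∷ C)
      v∷C = proj₁ max

      C-max : ∀ D → S.IsChain (v ∷ D) → C ⊆ D → D ⊆ C
      C-max = proj₂ max

      a∈ : a ∈ map value (v ∷ C)
      a∈ with ≤⇒≡⊎< (a≤ v) | any? (λ c → value c ≟ a) C
      ... | inj₁ a≡v | _       = here a≡v
      ... | inj₂ _   | yes any with find any
      ...   | c , c∈C , refl   = there (∈-map⁺ value c∈C)
      a∈ | inj₂ a<v  | no ¬any =
        there (∈-map⁺ value (C-max (C ++ bot ∷ []) extended (λ c∈C → ∈-++⁺ˡ c∈C)
                                   (∈-++⁺ʳ C (here refl))))
        where
        above : All (λ c → bot S.< c) (v ∷ C)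
        above = <⁻ a<v ∷ All.tabulate λ {c} c∈C →
          <⁻ (a≤ c , λ a≡c → ¬any (lose c∈C (sym a≡c)))

        extended : S.IsChain ((v ∷ C) ++ bot ∷ [])
        extended = AllPairsP.++⁺ v∷C ([] ∷ []) (All.map (λ b<c → b<c ∷ []) above)

      below : ∀ {m} → m ∈ M → m < a
      below m∈M with M-chain
      ... | M<a ∷ _ = All.lookup M<a m∈M

      lift : IsMaximalChain (value v) (map value C ++ M)
      lift = AllPairsP.++⁺ (chain⁺ v∷C) (AllPairs.tail M-chain)
               (AllP.map⁺ {xs = v ∷ C} (All.tabulate λ {c} _ →
                 All.tabulate λ m∈M → <-≤-trans (below m∈M) (a≤ c)))
           , lift-max
        where
        lift-max : ∀ D → IsChain (value v ∷ D) → map value C ++ M ⊆ D → D ⊆ map value C ++ M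
        lift-max D ch C++M⊆D {d} d∈D with comparable ch (there d∈D) a∈D
          where
          a∈D : a ∈ value v ∷ D
          a∈D with a∈
          ... | here a≡v = here a≡v
          ... | there a∈C = there (C++M⊆D (∈-++⁺ˡ a∈C))
        ... | inj₁ refl       = ∈-++⁺ˡ (maximal max D ch (C++M⊆D ∘ ∈-++⁺ˡ) d∈D ≤-refl)
        ... | inj₂ (inj₂ a<d) = ∈-++⁺ˡ (maximal max D ch (C++M⊆D ∘ ∈-++⁺ˡ) d∈D (proj₁ a<d))
        ... | inj₂ (inj₁ d<a) = ∈-++⁺ʳ (map value C)
          (M-max (filter (_<? a) D)
                 (AllP.all-filter (_<? a) D ∷ AllPairsP.filter⁺ (_<? a) (AllPairs.tail ch))
                 (λ m∈M → ∈-filter⁺ (_<? a) (C++M⊆D (∈-++⁺ʳ (map value C) m∈M)) (below m∈M))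
                 (∈-filter⁺ (_<? a) d∈D d<a))

      length-C : length C ≡ rk (value v) ∸ rk a
      length-C = begin
        length C                                    ≡⟨ ℕP.m+n∸n≡m (length C) (length M) ⟨
        length C ℕ.+ length M ∸ length M            ≡⟨ cong (λ n → n ℕ.+ length M ∸ length M) (length-map value C) ⟨
        length (map value C) ℕ.+ length M ∸ length M ≡⟨ cong (_∸ length M) (length-++ (map value C)) ⟨
        length (map value C ++ M) ∸ length M        ≡⟨ cong (_∸ length M) (ranked (value v) _ lift) ⟩
        rk (value v) ∸ length M                     ≡⟨ cong (rk (value v) ∸_) (ranked a M (proj₂ (maximalChain a))) ⟩
        rk (value v) ∸ rk a                         ∎
        where open ≡-Reasoning

------------------------------------------------------------------------
-- Locally geometric and divisional posets

record IsGeometricLattice (L : RankedPoset) : Set where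
  open RankedPoset L
  field
    _∨_       : Carrier → Carrier → Carrier
    _∧_       : Carrier → Carrier → Carrier
    isLattice : IsLattice _≡_ _≤_ _∨_ _∧_
    geometric : ∀ x y → x ⋖ y ⇔ (∃ λ a → Atom a × ¬ (a ≤ x) × y ≡ x ∨ a)

LocallyGeometric : RankedPoset → Set
LocallyGeometric P = ∀ x → IsGeometricLattice (P≤ P x)

-- {0̂} is any one-element poset; it is trivially (locally) geometric.
data Divisional (P : RankedPoset) : Set where
  trivial : (∀ x → x ≡ RankedPoset.0̂ P) → Divisional P
  step    : LocallyGeometric P → ∀ a → RankedPoset.Atom P a →
            Divisional (P≥ P a) →
            RankedPoset.χ (P≥ P a) ∣ₚ RankedPoset.χ P →
            Divisional P

-- Each P≥ a used in the derivation has rank exactly one less than its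
-- predecessor.  This is automatic if all maximal elements of P have the
-- same rank, but not in general: rk (P≥ a) is the restriction of
-- rk P - 1, yet its maximum is smaller than rank P - 1 when a lies below
-- no element of top rank.  If a is an atom that is also maximal, P≥ a is
-- a point and χ = 1 divides everything; adjoining such an atom to the
-- Boolean lattice of rank 2 gives a divisional poset with
-- χ = t² - 3t + 1, which is not factorable.
RankDropsByOne : ∀ {P} → Divisional P → Set
RankDropsByOne     (trivial _)      = ⊤
RankDropsByOne {P} (step _ a _ d _) =
  RankedPoset.rank P ≡ suc (RankedPoset.rank (P≥ P a)) × RankDropsByOne d

-- Write χ″ for the characteristic polynomial of P≥ a.  Both χ and χ″ are
-- monic, and their degrees differ by one, so χ = (t - d) χ″ with d an
-- integer, and χ″ splits by induction.  That d is positive follows from the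
-- sign theorem of Rota: (-1)^rk(x) μ(0̂,x) > 0 when P is locally geometric.
-- It implies that χ has no root z ≤ 0, since (-1)^rank(P) χ(z) is then a sum
-- of nonnegative terms, among which those with rk x = rank P are positive.
-- Counting atoms would not do: an atom b may have several joins with a, so
-- P≥ a may have at least as many atoms as P.

module Submission where

open import Defs
open import Data.Nat using (ℕ; _<_)
open import Data.Product using (∃; _×_)
open import Data.Vec using (Vec)
open import Data.Vec.Relation.Unary.All using (All)

open import Data.Integer.Base as ℤ using (ℤ; +_; -_; -[1+_]; 0ℤ; 1ℤ; -1ℤ; +≤+; +<+)
import Data.Integer.Properties as ℤP
open import Data.Integer.Tactic.RingSolver using (solve-∀)
open import Data.Irrelevant using ([_])
open import Data.List.Base using (List; []; _∷_; filter; foldr; length; map)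
open import Data.List.Extrema.Nat using (argmax-sel; xs≤max)
open import Data.List.Membership.Propositional using (_∈_)
open import Data.List.Membership.Propositional.Properties using (∈-map⁺; ∈-map⁻; ∈-filter⁺)
open import Data.List.Properties using (map-cong)
import Data.List.Relation.Unary.All as ListAll
import Data.List.Relation.Unary.All.Properties as ListAllP
open import Data.List.Relation.Unary.AllPairs using ([]; _∷_)
import Data.List.Relation.Unary.AllPairs.Properties as AllPairsP
open import Data.List.Relation.Unary.Any using (here; there)
open import Data.List.Relation.Unary.Unique.Propositional using (Unique)
open import Data.Nat.Base as ℕ using (zero; suc; _∸_; z≤n; s≤s)
import Data.Nat.Properties as ℕP
open import Data.Product.Base using (_,_; proj₁; proj₂)
open import Data.Refinement using (value; _,_)
open import Data.Refinement.Properties using (value-injective)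
open import Data.Sum.Base using (inj₁; inj₂)
open import Data.Vec.Base using ([]; _∷_)
open import Data.Vec.Relation.Unary.All using ([]; _∷_)
open import Function.Base using (_∘_; id)
open import Function.Bundles using (Equivalence)
open import Induction.WellFounded using (Acc; acc)
open import Relation.Binary.Lattice.Structures using (IsLattice)
open import Relation.Binary.PropositionalEquality
  using (_≡_; _≢_; refl; sym; trans; cong; cong₂; subst; module ≡-Reasoning)
open import Relation.Nullary using (¬_; Dec; yes; no; contradiction)
open import Relation.Nullary.Decidable using (_×-dec_)
open import Relation.Unary using (Pred; Decidable)

-- Finite sums of integers

∑ : ∀ {A : Set} → List A → (A → ℤ) → ℤ
∑ xs f = foldr ℤ._+_ 0ℤ (map f xs)

-- Restricting a sum by an indicator keeps its index list fixed, so that sums over different subsets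
-- can be added, interchanged and compared termwise.
when : ∀ {A : Set} → Dec A → ℤ → ℤ
when (yes _) v = v
when (no  _) v = 0ℤ

when-true : ∀ {A : Set} (d : Dec A) {v} → A → when d v ≡ v
when-true (yes _) a = refl
when-true (no ¬a) a = contradiction a ¬a

when-false : ∀ {A : Set} (d : Dec A) {v} → ¬ A → when d v ≡ 0ℤ
when-false (yes a) ¬a = contradiction a ¬a
when-false (no _)  ¬a = refl

when-⇔ : ∀ {A B : Set} (d : Dec A) (e : Dec B) {v} → (A → B) → (B → A) → when d v ≡ when e v
when-⇔ (yes a) e A→B B→A = sym (when-true e (A→B a))
when-⇔ (no ¬a) e A→B B→A = sym (when-false e (¬a ∘ B→A))

when-* : ∀ {A : Set} (d : Dec A) c v → when d (c ℤ.* v) ≡ c ℤ.* when d v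
when-* (yes _) c v = refl
when-* (no _)  c v = sym (ℤP.*-zeroʳ c)

when-when : ∀ {A B : Set} (d : Dec A) (e : Dec B) {v} → (B → A) → when d (when e v) ≡ when e v
when-when d (yes b) B→A = when-true d (B→A b)
when-when (yes _) (no _) B→A = refl
when-when (no _)  (no _) B→A = refl

module _ {A : Set} where

  ∑-cong : ∀ {f g : A → ℤ} → (∀ x → f x ≡ g x) → ∀ xs → ∑ xs f ≡ ∑ xs g
  ∑-cong f≗g xs = cong (foldr ℤ._+_ 0ℤ) (map-cong f≗g xs)

  ∑-zero : ∀ {f : A → ℤ} → (∀ x → f x ≡ 0ℤ) → ∀ xs → ∑ xs f ≡ 0ℤ
  ∑-zero f≗0 []       = refl
  ∑-zero f≗0 (x ∷ xs) rewrite f≗0 x | ∑-zero f≗0 xs = refl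

  ∑-+ : ∀ (f g : A → ℤ) xs → ∑ xs (λ x → f x ℤ.+ g x) ≡ ∑ xs f ℤ.+ ∑ xs g
  ∑-+ f g []       = refl
  ∑-+ f g (x ∷ xs) rewrite ∑-+ f g xs = lemma (f x) (g x) (∑ xs f) (∑ xs g)
    where
    lemma : ∀ a b c d → (a ℤ.+ b) ℤ.+ (c ℤ.+ d) ≡ (a ℤ.+ c) ℤ.+ (b ℤ.+ d)
    lemma = solve-∀

  ∑-* : ∀ c (f : A → ℤ) xs → ∑ xs (λ x → c ℤ.* f x) ≡ c ℤ.* ∑ xs f
  ∑-* c f []       = sym (ℤP.*-zeroʳ c)
  ∑-* c f (x ∷ xs) rewrite ∑-* c f xs = sym (ℤP.*-distribˡ-+ c (f x) (∑ xs f))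

  ∑-when : ∀ {B : Set} (d : Dec B) (f : A → ℤ) xs → ∑ xs (λ x → when d (f x)) ≡ when d (∑ xs f)
  ∑-when (yes _) f xs = refl
  ∑-when (no  _) f xs = ∑-zero (λ _ → refl) xs

  ∑-single : ∀ {f : A → ℤ} {x xs} → Unique xs → x ∈ xs → (∀ z → z ≢ x → f z ≡ 0ℤ) → ∑ xs f ≡ f x
  ∑-single {f} {x} (x∉ ∷ _) (here refl) f≡0 =
    trans (cong (ℤ._+_ (f x)) (go x∉)) (ℤP.+-identityʳ (f x))
    where
    go : ∀ {ys} → ListAll.All (x ≢_) ys → ∑ ys f ≡ 0ℤ
    go ListAll.[] = refl
    go (x≢y ListAll.∷ x∉ys) rewrite f≡0 _ (x≢y ∘ sym) | go x∉ys = refl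
  ∑-single {f} {x} {y ∷ ys} (y∉ ∷ u) (there x∈) f≡0
    rewrite f≡0 y (ListAll.lookup y∉ x∈) = trans (ℤP.+-identityˡ (∑ ys f)) (∑-single u x∈ f≡0)

  ∑-nonneg : ∀ {f : A → ℤ} → (∀ x → 0ℤ ℤ.≤ f x) → ∀ xs → 0ℤ ℤ.≤ ∑ xs f
  ∑-nonneg 0≤f []       = ℤP.≤-refl
  ∑-nonneg 0≤f (x ∷ xs) = ℤP.+-mono-≤ (0≤f x) (∑-nonneg 0≤f xs)

  ∑-pos : ∀ {f : A → ℤ} {x xs} → (∀ x → 0ℤ ℤ.≤ f x) → x ∈ xs → 0ℤ ℤ.< f x → 0ℤ ℤ.< ∑ xs f
  ∑-pos {xs = _ ∷ xs} 0≤f (here refl) 0<fx = ℤP.+-mono-<-≤ 0<fx (∑-nonneg 0≤f xs)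
  ∑-pos {xs = y ∷ _}  0≤f (there x∈)  0<fx = ℤP.+-mono-≤-< (0≤f y) (∑-pos 0≤f x∈ 0<fx)

∑-swap : ∀ {A B : Set} (f : A → B → ℤ) xs ys →
         ∑ xs (λ x → ∑ ys (f x)) ≡ ∑ ys (λ y → ∑ xs (λ x → f x y))
∑-swap f []       ys = sym (∑-zero (λ _ → refl) ys)
∑-swap f (x ∷ xs) ys = trans (cong (ℤ._+_ (∑ ys (f x))) (∑-swap f xs ys))
                             (sym (∑-+ (f x) (λ y → ∑ xs (λ x → f x y)) ys))

∑-restrict : ∀ {A : Set} {Q : Pred A _} (Q? : Decidable Q) (f : A → ℤ) xs →
             ∑ (restrict Q? xs) (f ∘ value) ≡ ∑ xs (λ x → when (Q? x) (f x))
∑-restrict Q? f []       = refl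
∑-restrict Q? f (x ∷ xs) with Q? x
... | yes _ = cong (ℤ._+_ (f x)) (∑-restrict Q? f xs)
... | no  _ = trans (∑-restrict Q? f xs) (sym (ℤP.+-identityˡ _))

-- The Möbius function

module _ (P : FinitePoset) where
  open FinitePoset P renaming (_<_ to infix 4 _≺_)

  -- The summand of möbius is a local function without a name outside Defs, so
  -- the types of the two lemmas about it leave it to be inferred from their uses.
  mutual
    möbius-irrelevant : ∀ x y (p q : Acc _≺_ y) → möbius x y p ≡ möbius x y q
    möbius-irrelevant x y (acc rs) (acc rs′) with x ≟ y
    ... | yes _   = refl
    ... | no  x≢y = cong (λ zs → - foldr ℤ._+_ 0ℤ zs) (map-cong (term-irrelevant x y rs rs′ x≢y) elements)

    term-irrelevant : ∀ x y (rs rs′ : ∀ {z} → z ≺ y → Acc _≺_ z) (x≢y : x ≢ y) z → _ ≡ _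
    term-irrelevant x y rs rs′ x≢y z with (x ≤? z) ×-dec (z <? y)
    ... | yes (_ , z<y) = möbius-irrelevant x z (rs z<y) (rs′ z<y)
    ... | no  _         = refl

  mutual
    -- The recursive calls of `möbius` carry accessibility proofs extracted from `p`, while `μ` uses
    -- those of `<-wellFounded`; `möbius-irrelevant` exchanges them.
    möbius-recursion : ∀ x y (p : Acc _≺_ y) → x ≢ y →
                       möbius x y p ≡ - ∑ elements (λ z → when ((x ≤? z) ×-dec (z <? y)) (μ x z))
    möbius-recursion x y (acc rs) x≢y with x ≟ y
    ... | yes x≡y = contradiction x≡y x≢y
    ... | no  x≢y = cong (λ zs → - foldr ℤ._+_ 0ℤ zs) (map-cong (term-recursion x y rs x≢y) elements)

    term-recursion : ∀ x y (rs : ∀ {z} → z ≺ y → Acc _≺_ z)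
                     (x≢y : x ≢ y) z → _ ≡ when ((x ≤? z) ×-dec (z <? y)) (μ x z)
    term-recursion x y rs x≢y z with (x ≤? z) ×-dec (z <? y)
    ... | yes (_ , z<y) = möbius-irrelevant x z (rs z<y) (<-wellFounded z)
    ... | no  _         = refl

  μ-refl : ∀ x → μ x x ≡ 1ℤ
  μ-refl x with <-wellFounded x
  ... | acc rs with x ≟ x
  ...   | yes _   = refl
  ...   | no  x≢x = contradiction refl x≢x

-- Ranks and Möbius sums in a ranked poset

module _ (P : RankedPoset) where
  open RankedPoset P renaming (_<_ to infix 4 _≺_)

  private
    ≤-split : ∀ z y v (d : Dec (z ≡ y)) →
              when (z ≤? y) v ≡ when ((0̂ ≤? z) ×-dec (z <? y)) v ℤ.+ when d v
    ≤-split z .z v (yes refl) =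
      trans (when-true (z ≤? z) ≤-refl)
            (sym (trans (cong (ℤ._+ v) (when-false ((0̂ ≤? z) ×-dec (z <? z)) (<-irrefl ∘ proj₂)))
                        (ℤP.+-identityˡ v)))
    ≤-split z y v (no z≢y) =
      trans (when-⇔ (z ≤? y) ((0̂ ≤? z) ×-dec (z <? y))
                    (λ z≤y → 0̂-minimum z , z≤y , z≢y) (proj₁ ∘ proj₂))
            (sym (ℤP.+-identityʳ _))

  -- The recursion makes `μ 0̂ y` the negative of the sum over the elements strictly below `y`;
  -- `≤-split` separates the term at `y`, and the two parts cancel.
  ∑μ≡0 : ∀ {y} → y ≢ 0̂ → ∑ elements (λ z → when (z ≤? y) (μ 0̂ z)) ≡ 0ℤ
  ∑μ≡0 {y} y≢0̂ = begin
    ∑ elements (λ z → when (z ≤? y) (μ 0̂ z))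
      ≡⟨ ∑-cong (λ z → ≤-split z y (μ 0̂ z) (z ≟ y)) elements ⟩
    ∑ elements (λ z → below z ℤ.+ at z)
      ≡⟨ ∑-+ below at elements ⟩
    ∑ elements below ℤ.+ ∑ elements at
      ≡⟨ cong (ℤ._+_ (∑ elements below)) (∑-single unique (complete y) (λ z → when-false (z ≟ y))) ⟩
    ∑ elements below ℤ.+ at y
      ≡⟨ cong (ℤ._+_ (∑ elements below)) (when-true (y ≟ y) refl) ⟩
    ∑ elements below ℤ.+ μ 0̂ y
      ≡⟨ cong (ℤ._+_ (∑ elements below))
              (möbius-recursion finitePoset 0̂ y (<-wellFounded y) (y≢0̂ ∘ sym)) ⟩
    ∑ elements below ℤ.+ - ∑ elements below
      ≡⟨ ℤP.+-inverseʳ (∑ elements below) ⟩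
    0ℤ ∎
    where
    open ≡-Reasoning
    below at : Carrier → ℤ
    below z = when ((0̂ ≤? z) ×-dec (z <? y)) (μ 0̂ z)
    at z = when (z ≟ y) (μ 0̂ z)

  -- Prepending `x` to a maximal chain below `x` gives a maximal chain below `y`: a further member
  -- cannot lie above `x` by the cover relation, and one below `x` is already present by maximality.
  rk-⋖ : ∀ {x y} → x ⋖ y → rk y ≡ suc (rk x)
  rk-⋖ {x} {y} (x<y , nothing-between) with maximalChain x
  ... | C , x∷C@(C<x ∷ _) , C-max =
    trans (sym (ranked y (x ∷ C) (y∷x∷C , x∷C-max))) (cong suc (ranked x C (x∷C , C-max)))
    where
    y∷x∷C : IsChain (y ∷ x ∷ C)
    y∷x∷C = (x<y ListAll.∷ ListAll.map (λ c<x → <-trans c<x x<y) C<x) ∷ x∷C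

    x∷C-max : ∀ D → IsChain (y ∷ D) → (∀ {c} → c ∈ x ∷ C → c ∈ D) → ∀ {d} → d ∈ D → d ∈ x ∷ C
    x∷C-max D (D<y ∷ D-chain) C⊆D {d} d∈D with comparable D-chain d∈D (C⊆D (here refl))
    ... | inj₁ d≡x        = here d≡x
    ... | inj₂ (inj₂ x<d) = contradiction (ListAll.lookup D<y d∈D) (nothing-between d x<d)
    ... | inj₂ (inj₁ d<x) = there
      (C-max (filter (_<? x) D)
             (ListAllP.all-filter (_<? x) D ∷ AllPairsP.filter⁺ (_<? x) D-chain)
             (λ c∈C → ∈-filter⁺ (_<? x) (C⊆D (there c∈C)) (ListAll.lookup C<x c∈C))
             (∈-filter⁺ (_<? x) d∈D d<x))

  rk-0̂ : rk 0̂ ≡ 0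
  rk-0̂ = sym (ranked 0̂ [] (ListAll.[] ∷ [] , λ where
    (d ∷ _) ((d<0̂ ListAll.∷ _) ∷ _) _ (here refl) → below-0̂ d<0̂
    (_ ∷ _) ((_ ListAll.∷ D<0̂) ∷ _) _ (there e∈)  → below-0̂ (ListAll.lookup D<0̂ e∈)))
    where
    below-0̂ : ∀ {A : Set} {d} → d ≺ 0̂ → A
    below-0̂ {d = d} (d≤0̂ , d≢0̂) = contradiction (0̂-minimal d d≤0̂) d≢0̂

  -- Descend from `y` through elements covered by the previous one and still above `x`; each descent
  -- lowers the rank by one.
  rk-mono-< : ∀ {x y} → x ≺ y → rk x ℕ.< rk y
  rk-mono-< {x} {y} = go y (<-wellFounded y)
    where
    go : ∀ y → Acc _≺_ y → x ≺ y → rk x ℕ.< rk y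
    go y (acc rs) x<y with coatom x<y
    ... | w , x≤w , w⋖y with ≤⇒≡⊎< x≤w
    ...   | inj₁ refl = ℕP.≤-reflexive (sym (rk-⋖ w⋖y))
    ...   | inj₂ x<w  = ℕP.<-trans (go w (rs (proj₁ w⋖y)) x<w) (ℕP.≤-reflexive (sym (rk-⋖ w⋖y)))

  rk≡0⇒≡0̂ : ∀ {x} → rk x ≡ 0 → x ≡ 0̂
  rk≡0⇒≡0̂ {x} rk≡0 with ≤⇒≡⊎< (0̂-minimum x)
  ... | inj₁ 0̂≡x = sym 0̂≡x
  ... | inj₂ 0̂<x = contradiction (subst (rk 0̂ ℕ.<_) rk≡0 (rk-mono-< 0̂<x)) λ ()

  -- Descending from `x` by covers reaches an element that covers `0̂`, and `rk-⋖` gives it rank 1.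
  atom-below : ∀ {x} → 0̂ ≺ x → ∃ λ a → Atom a × a ≤ x
  atom-below {x} = go x (<-wellFounded x)
    where
    go : ∀ x → Acc _≺_ x → 0̂ ≺ x → ∃ λ a → Atom a × a ≤ x
    go x (acc rs) 0̂<x with coatom 0̂<x
    ... | w , 0̂≤w , w⋖x@(w<x , _) with ≤⇒≡⊎< 0̂≤w
    ...   | inj₁ refl = x , trans (rk-⋖ w⋖x) (cong suc rk-0̂) , ≤-refl
    ...   | inj₂ 0̂<w with go w (rs w<x) 0̂<w
    ...     | a , atom , a≤w = a , atom , ≤-trans a≤w (proj₁ w<x)

  rk≤rank : ∀ x → rk x ℕ.≤ rank
  rk≤rank x = ListAll.lookup (xs≤max 0 (map rk elements)) (∈-map⁺ rk (complete x))

  rank-attained : ∃ λ x → rk x ≡ rank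
  -- `rank` is a maximum with default 0. If the default is selected, `0̂` attains it.
  rank-attained with argmax-sel id 0 (map rk elements)
  ... | inj₁ rank≡0 = 0̂ , trans rk-0̂ (sym rank≡0)
  ... | inj₂ rank∈ with ∈-map⁻ rk rank∈
  ...   | x , _ , rank≡ = x , sym rank≡

-- Geometric lattices

module _ (L : RankedPoset) (geometricLattice : IsGeometricLattice L) where
  open RankedPoset L renaming (_<_ to infix 4 _≺_)
  open IsGeometricLattice geometricLattice
  open IsLattice isLattice using (x≤x∨y; y≤x∨y; ∨-least)

  ∨-atom-⋖ : ∀ {x a} → Atom a → ¬ (a ≤ x) → x ⋖ (x ∨ a)
  ∨-atom-⋖ {x} {a} atom a≰x = Equivalence.from (geometric x (x ∨ a)) (a , atom , a≰x , refl)

  -- Climb one cover at a time from z while avoiding a: if z ∨ a is not the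
  -- top, there is an atom c below neither z ∨ a nor a coatom above it, and
  -- z ∨ c is again not above a.
  ∃-complement-coatom : ∀ {a t} → Atom a → (∀ z → z ≤ t) → ∃ λ z → ¬ (a ≤ z) × z ∨ a ≡ t
  ∃-complement-coatom {a} {t} atom ≤t = climb (rk t) 0̂ a≰0̂ (ℕP.m≤n+m (rk t) (rk 0̂))
    where
    a≰0̂ : ¬ (a ≤ 0̂)
    a≰0̂ a≤0̂ with 0̂-minimal a a≤0̂
    ... | refl = contradiction (trans (sym atom) (rk-0̂ L)) λ ()

    -- `n` bounds the rank still to be climbed. Once it is 0, `z` must be `t`, which contradicts
    -- `¬ (a ≤ z)`.
    climb : ∀ n z → ¬ (a ≤ z) → rk t ℕ.≤ rk z ℕ.+ n → ∃ λ z → ¬ (a ≤ z) × z ∨ a ≡ t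
    climb zero z a≰z rk-t≤ with ≤⇒≡⊎< (≤t z)
    ... | inj₁ refl = contradiction (≤t a) a≰z
    ... | inj₂ z<t  = contradiction (ℕP.≤-trans rk-t≤ (ℕP.≤-reflexive (ℕP.+-identityʳ (rk z))))
                                    (ℕP.<⇒≱ (rk-mono-< L z<t))
    climb (suc n) z a≰z rk-t≤ with ≤⇒≡⊎< (≤t (z ∨ a))
    ... | inj₁ z∨a≡t = z , a≰z , z∨a≡t
    ... | inj₂ z∨a<t with coatom z∨a<t
    ...   | w , z∨a≤w , w⋖t with Equivalence.to (geometric w t) w⋖t
    ...     | c , atom-c , c≰w , _ = climb n (z ∨ c) a≰z∨c rk-t≤′
      where
      c≰z∨a : ¬ (c ≤ z ∨ a)
      c≰z∨a c≤ = c≰w (≤-trans c≤ z∨a≤w)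

      z⋖z∨c : z ⋖ (z ∨ c)
      z⋖z∨c = ∨-atom-⋖ atom-c (λ c≤z → c≰z∨a (≤-trans c≤z (x≤x∨y z a)))

      -- Otherwise `z ∨ a ≤ z ∨ c`. Equality would put `c` below `z ∨ a`, and strict inequality
      -- would put `z ∨ a` strictly between `z` and its cover `z ∨ c`.
      a≰z∨c : ¬ (a ≤ z ∨ c)
      a≰z∨c a≤ with ≤⇒≡⊎< (∨-least (x≤x∨y z c) a≤)
      ... | inj₁ z∨a≡z∨c = c≰z∨a (subst (c ≤_) (sym z∨a≡z∨c) (y≤x∨y z c))
      ... | inj₂ z∨a<z∨c = proj₂ z⋖z∨c (z ∨ a) (proj₁ (∨-atom-⋖ atom a≰z)) z∨a<z∨c

      rk-t≤′ : rk t ℕ.≤ rk (z ∨ c) ℕ.+ n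
      rk-t≤′ rewrite rk-⋖ L z⋖z∨c = subst (rk t ℕ.≤_) (ℕP.+-suc (rk z) n) rk-t≤

  -- Weisner's theorem, for any g that shares with μ 0̂ the vanishing of its
  -- sums over the principal ideals below elements above a.
  weisner : ∀ {a} (g : Carrier → ℤ) →
            (∀ w → a ≤ w → ∑ elements (λ z → when (z ≤? w) (g z)) ≡ 0ℤ) →
            ∀ w → a ≤ w → ∑ elements (λ z → when (z ∨ a ≟ w) (g z)) ≡ 0ℤ
  weisner {a} g ∑g≡0 w = go w (<-wellFounded w)
    where
    open ≡-Reasoning

    fibre : Carrier → ℤ
    fibre u = ∑ elements (λ z → when (z ∨ a ≟ u) (g z))

    fibre-≱a : ∀ u → ¬ (a ≤ u) → fibre u ≡ 0ℤ
    fibre-≱a u a≰u = ∑-zero (λ z → when-false (z ∨ a ≟ u) (λ { refl → a≰u (y≤x∨y z a) })) elements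

    go : ∀ w → Acc _≺_ w → a ≤ w → fibre w ≡ 0ℤ
    -- Since `a ≤ w`, `z ≤ w` holds exactly when `z ∨ a ≤ w`, so grouping by `u = z ∨ a` writes the
    -- sum over the ideal below `w` as the sum of `fibre u` over `u ≤ w`. The fibres with `u ≺ w`
    -- vanish, by induction if `a ≤ u` and as empty sums otherwise, which leaves `fibre w`.
    go w (acc rs) a≤w = begin
      fibre w
        ≡⟨ when-true (w ≤? w) ≤-refl ⟨
      when (w ≤? w) (fibre w)
        ≡⟨ ∑-single unique (complete w) fibre-≢w ⟨
      ∑ elements (λ u → when (u ≤? w) (fibre u))
        ≡⟨ ∑-cong (λ u → ∑-when (u ≤? w) (λ z → when (z ∨ a ≟ u) (g z)) elements) elements ⟨
      ∑ elements (λ u → ∑ elements (λ z → when (u ≤? w) (when (z ∨ a ≟ u) (g z))))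
        ≡⟨ ∑-swap (λ u z → when (u ≤? w) (when (z ∨ a ≟ u) (g z))) elements elements ⟩
      ∑ elements (λ z → ∑ elements (λ u → when (u ≤? w) (when (z ∨ a ≟ u) (g z))))
        ≡⟨ ∑-cong collapse elements ⟩
      ∑ elements (λ z → when (z ≤? w) (g z))
        ≡⟨ ∑g≡0 w a≤w ⟩
      0ℤ ∎
      where
      fibre-≢w : ∀ u → u ≢ w → when (u ≤? w) (fibre u) ≡ 0ℤ
      fibre-≢w u u≢w with u ≤? w
      ... | no  _   = refl
      ... | yes u≤w with a ≤? u
      ...   | yes a≤u = go u (rs (u≤w , u≢w)) a≤u
      ...   | no  a≰u = fibre-≱a u a≰u

      collapse : ∀ z → ∑ elements (λ u → when (u ≤? w) (when (z ∨ a ≟ u) (g z))) ≡ when (z ≤? w) (g z)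
      collapse z = begin
        ∑ elements (λ u → when (u ≤? w) (when (z ∨ a ≟ u) (g z)))
          ≡⟨ ∑-single unique (complete (z ∨ a)) ≢-z∨a ⟩
        when (z ∨ a ≤? w) (when (z ∨ a ≟ z ∨ a) (g z))
          ≡⟨ cong (when (z ∨ a ≤? w)) (when-true (z ∨ a ≟ z ∨ a) refl) ⟩
        when (z ∨ a ≤? w) (g z)
          ≡⟨ when-⇔ (z ∨ a ≤? w) (z ≤? w) (≤-trans (x≤x∨y z a)) (λ z≤w → ∨-least z≤w a≤w) ⟩
        when (z ≤? w) (g z) ∎
        where
        ≢-z∨a : ∀ u → u ≢ z ∨ a → when (u ≤? w) (when (z ∨ a ≟ u) (g z)) ≡ 0ℤ
        ≢-z∨a u u≢ with u ≤? w
        ... | yes _ = when-false (z ∨ a ≟ u) (u≢ ∘ sym)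
        ... | no  _ = refl

-- The sign of the Möbius function

sgn : ℕ → ℤ
sgn n = -1ℤ ℤ.^ n

sgn-suc-suc : ∀ n → sgn (suc (suc n)) ≡ sgn n
sgn-suc-suc n = lemma (sgn n)
  where
  lemma : ∀ i → -1ℤ ℤ.* (-1ℤ ℤ.* i) ≡ i
  lemma = solve-∀

module _ (P : RankedPoset) (locallyGeometric : LocallyGeometric P) where
  open RankedPoset P renaming (_<_ to infix 4 _≺_)

  -- By Weisner's theorem in P≤ x, μ 0̂ x is minus the sum of the μ 0̂ z over
  -- the elements z covered by x that do not lie above a fixed atom.
  sgn-μ-pos : ∀ x → 0ℤ ℤ.< sgn (rk x) ℤ.* μ 0̂ x
  sgn-μ-pos x = go x (<-wellFounded x)
    where
    go : ∀ x → Acc _≺_ x → 0ℤ ℤ.< sgn (rk x) ℤ.* μ 0̂ x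
    go x (acc rs) with ≤⇒≡⊎< (0̂-minimum x)
    ... | inj₁ refl rewrite rk-0̂ P | μ-refl finitePoset 0̂ = +<+ (s≤s z≤n)
    ... | inj₂ 0̂<x with atom-below P 0̂<x
    ...   | a , atom , a≤x =
      subst (0ℤ ℤ.<_) -h-top (ℤP.neg-mono-< (ℤP.≰⇒> h-top≱0))
      where
      L : RankedPoset
      L = P≤ P x

      module L = RankedPoset L

      open IsGeometricLattice (locallyGeometric x)
      open IsLattice isLattice using (x≤x∨y; ∨-least)

      top atomL : L.Carrier
      top   = x , [ ≤-refl ]
      atomL = a , [ a≤x ]

      ≤top : ∀ z → z L.≤ top
      ≤top = holds (_≤? x)

      -- This is the sign for the elements covered by `x`, whose rank is one less than that of `x`;
      -- `suc` has the same parity and avoids truncated subtraction.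
      s : ℤ
      s = sgn (suc (rk x))

      h : L.Carrier → ℤ
      h z = when (z ∨ atomL L.≟ top) (s ℤ.* μ 0̂ (value z))

      ≱a⇒pos : ∀ z → ¬ (a ≤ value z) → z ∨ atomL ≡ top → 0ℤ ℤ.< s ℤ.* μ 0̂ (value z)
      ≱a⇒pos z a≰z z∨a≡top = subst (λ i → 0ℤ ℤ.< i ℤ.* μ 0̂ (value z)) sgn-z (go (value z) (rs z<x))
        where
        z⋖top : z L.⋖ top
        z⋖top = subst (z L.⋖_) z∨a≡top (∨-atom-⋖ L (locallyGeometric x) atom a≰z)

        z<x : value z ≺ x
        z<x = proj₁ (proj₁ z⋖top) , proj₂ (proj₁ z⋖top) ∘ value-injective

        sgn-z : sgn (rk (value z)) ≡ s
        sgn-z = trans (sym (sgn-suc-suc (rk (value z)))) (cong (sgn ∘ suc) (sym (rk-⋖ L z⋖top)))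

      h≥0 : ∀ z → z ≢ top → 0ℤ ℤ.≤ h z
      h≥0 z z≢top with z ∨ atomL L.≟ top
      ... | no  _       = ℤP.≤-refl
      ... | yes z∨a≡top = ℤP.<⇒≤ (≱a⇒pos z a≰z z∨a≡top)
        where
        -- If `z` were above `a`, then `z ∨ a` would be `z` itself, hence `z` would be `top`.
        a≰z : ¬ (a ≤ value z)
        a≰z a≤z = z≢top (L.≤-antisym (≤top z)
          (subst (L._≤ z) z∨a≡top (∨-least {z} {atomL} {z} (L.≤-refl {z}) a≤z)))

      -- The values of `μ` are those of `P`. As `w` lies below `x`, its ideal in `P≤ P x` is its
      -- ideal in `P`, where `∑μ≡0` applies because `w` is above an atom and so differs from `0̂`.
      ∑μ≡0-below : ∀ w → a ≤ value w →
                   ∑ L.elements (λ z → when (z L.≤? w) (s ℤ.* μ 0̂ (value z))) ≡ 0ℤ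
      ∑μ≡0-below w a≤w = begin
        ∑ L.elements (λ z → when (z L.≤? w) (s ℤ.* μ 0̂ (value z)))
          ≡⟨ ∑-restrict (_≤? x) (λ z → when (z ≤? value w) (s ℤ.* μ 0̂ z)) elements ⟩
        ∑ elements (λ z → when (z ≤? x) (when (z ≤? value w) (s ℤ.* μ 0̂ z)))
          ≡⟨ ∑-cong (λ z → trans (when-when (z ≤? x) (z ≤? value w) (λ z≤w → ≤-trans z≤w (≤top w)))
                                 (when-* (z ≤? value w) s (μ 0̂ z))) elements ⟩
        ∑ elements (λ z → s ℤ.* when (z ≤? value w) (μ 0̂ z))
          ≡⟨ ∑-* s _ elements ⟩
        s ℤ.* ∑ elements (λ z → when (z ≤? value w) (μ 0̂ z))
          ≡⟨ cong (s ℤ.*_) (∑μ≡0 P w≢0̂) ⟩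
        s ℤ.* 0ℤ
          ≡⟨ ℤP.*-zeroʳ s ⟩
        0ℤ ∎
        where
        open ≡-Reasoning
        w≢0̂ : value w ≢ 0̂
        w≢0̂ w≡0̂ = contradiction
          (trans (sym atom) (trans (cong rk (0̂-minimal a (subst (a ≤_) w≡0̂ a≤w))) (rk-0̂ P))) λ ()

      ∑h≡0 : ∑ L.elements h ≡ 0ℤ
      ∑h≡0 = weisner L (locallyGeometric x) {atomL} (λ z → s ℤ.* μ 0̂ (value z)) ∑μ≡0-below top a≤x

      -- If `h top` were nonnegative, every term of the vanishing Weisner sum would be, while the
      -- `z` from `∃-complement-coatom` contributes a positive one.
      h-top≱0 : ¬ (0ℤ ℤ.≤ h top)
      h-top≱0 h-top≥0 with ∃-complement-coatom L (locallyGeometric x) {atomL} atom ≤top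
      ... | z , a≰z , z∨a≡top = ℤP.<-irrefl (sym ∑h≡0) (∑-pos h≥0′ (L.complete z) h-z>0)
        where
        h≥0′ : ∀ z → 0ℤ ℤ.≤ h z
        h≥0′ z with z L.≟ top
        ... | yes refl  = h-top≥0
        ... | no  z≢top = h≥0 z z≢top

        h-z>0 : 0ℤ ℤ.< h z
        h-z>0 = subst (0ℤ ℤ.<_) (sym (when-true (z ∨ atomL L.≟ top) z∨a≡top)) (≱a⇒pos z a≰z z∨a≡top)

      -h-top : - h top ≡ sgn (rk x) ℤ.* μ 0̂ x
      -h-top = trans (cong -_ (when-true (top ∨ atomL L.≟ top) top∨a≡top)) (lemma (sgn (rk x)) (μ 0̂ x))
        where
        top∨a≡top : top ∨ atomL ≡ top
        top∨a≡top = L.≤-antisym (≤top (top ∨ atomL)) (x≤x∨y top atomL)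

        lemma : ∀ i j → - (-1ℤ ℤ.* i ℤ.* j) ≡ i ℤ.* j
        lemma = solve-∀

-- Polynomials

coeff-+ : ∀ p q k → coeff (p +ₚ q) k ≡ coeff p k ℤ.+ coeff q k
coeff-+ []      q       k       = sym (ℤP.+-identityˡ (coeff q k))
coeff-+ (c ∷ p) []      k       = sym (ℤP.+-identityʳ (coeff (c ∷ p) k))
coeff-+ (c ∷ p) (d ∷ q) zero    = refl
coeff-+ (c ∷ p) (d ∷ q) (suc k) = coeff-+ p q k

coeff-scale : ∀ c q k → coeff (map (c ℤ.*_) q) k ≡ c ℤ.* coeff q k
coeff-scale c []      k       = sym (ℤP.*-zeroʳ c)
coeff-scale c (d ∷ q) zero    = refl
coeff-scale c (d ∷ q) (suc k) = coeff-scale c q k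

-- Writing the shift as `0ℤ ∷ _` lets one formula cover both `k = 0` and successors.
coeff-∷-* : ∀ c p q k → coeff ((c ∷ p) *ₚ q) k ≡ c ℤ.* coeff q k ℤ.+ coeff (0ℤ ∷ p *ₚ q) k
coeff-∷-* c p q k = trans (coeff-+ (map (c ℤ.*_) q) (0ℤ ∷ p *ₚ q) k)
                          (cong (ℤ._+ coeff (0ℤ ∷ p *ₚ q) k) (coeff-scale c q k))

coeff-0∷[] : ∀ k → coeff (0ℤ ∷ []) k ≡ 0ℤ
coeff-0∷[] zero    = refl
coeff-0∷[] (suc k) = refl

-- The root is an arbitrary integer because its sign is settled only at the end; at `+ n` this
-- unfolds to the factor used in `∏[t-_]`.
t-_ : ℤ → Poly
t- d = - d ∷ 1ℤ ∷ []

coeff-linear : ∀ d p k → coeff ((t- d) *ₚ p) k ≡ - d ℤ.* coeff p k ℤ.+ coeff (0ℤ ∷ p) k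
coeff-linear d p k = trans (coeff-∷-* (- d) (1ℤ ∷ []) p k) (cong (ℤ._+_ (- d ℤ.* coeff p k)) (shift k))
  where
  shift : ∀ k → coeff (0ℤ ∷ (1ℤ ∷ []) *ₚ p) k ≡ coeff (0ℤ ∷ p) k
  shift zero    = refl
  shift (suc k) = trans (coeff-∷-* 1ℤ [] p k) (trans (cong (ℤ._+_ (1ℤ ℤ.* coeff p k)) (coeff-0∷[] k))
                    (trans (ℤP.+-identityʳ _) (ℤP.*-identityˡ _)))

*ₚ-congˡ : ∀ q {p p′} → p ≈ₚ p′ → q *ₚ p ≈ₚ q *ₚ p′
*ₚ-congˡ []      p≈p′ k = refl
*ₚ-congˡ (c ∷ q) {p} {p′} p≈p′ k = begin
  coeff ((c ∷ q) *ₚ p) k                         ≡⟨ coeff-∷-* c q p k ⟩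
  c ℤ.* coeff p k ℤ.+ coeff (0ℤ ∷ q *ₚ p) k      ≡⟨ cong₂ (λ i j → c ℤ.* i ℤ.+ j) (p≈p′ k) (shift k) ⟩
  c ℤ.* coeff p′ k ℤ.+ coeff (0ℤ ∷ q *ₚ p′) k    ≡⟨ coeff-∷-* c q p′ k ⟨
  coeff ((c ∷ q) *ₚ p′) k                        ∎
  where
  open ≡-Reasoning
  shift : ∀ k → coeff (0ℤ ∷ q *ₚ p) k ≡ coeff (0ℤ ∷ q *ₚ p′) k
  shift zero    = refl
  shift (suc k) = *ₚ-congˡ q p≈p′ k

*ₚ-zeroˡ : ∀ q p → q ≈ₚ [] → q *ₚ p ≈ₚ []
*ₚ-zeroˡ []      p q≈0 k = refl
*ₚ-zeroˡ (c ∷ q) p q≈0 k rewrite coeff-∷-* c q p k | q≈0 0 = trans (ℤP.+-identityˡ _) (shift k)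
  where
  shift : ∀ k → coeff (0ℤ ∷ q *ₚ p) k ≡ 0ℤ
  shift zero    = refl
  shift (suc k) = *ₚ-zeroˡ q p (q≈0 ∘ suc) k

-- Equal polynomials may be lists of different lengths. When one list ends, the rest of the other
-- consists of zeros, and `*ₚ-zeroˡ` applies.
*ₚ-congʳ : ∀ q q′ p → q ≈ₚ q′ → q *ₚ p ≈ₚ q′ *ₚ p
*ₚ-congʳ []      q′       p q≈q′ k = sym (*ₚ-zeroˡ q′ p (sym ∘ q≈q′) k)
*ₚ-congʳ (c ∷ q) []       p q≈q′ k = *ₚ-zeroˡ (c ∷ q) p q≈q′ k
*ₚ-congʳ (c ∷ q) (d ∷ q′) p q≈q′ k rewrite coeff-∷-* c q p k | coeff-∷-* d q′ p k =
  cong₂ (λ i j → i ℤ.* coeff p k ℤ.+ j) (q≈q′ 0) (shift k)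
  where
  shift : ∀ k → coeff (0ℤ ∷ q *ₚ p) k ≡ coeff (0ℤ ∷ q′ *ₚ p) k
  shift zero    = refl
  shift (suc k) = *ₚ-congʳ q q′ p (q≈q′ ∘ suc) k

-- Brings a factor of the product to the front, where `Monic-linear⁻` can strip it.
*ₚ-linear-comm : ∀ d q p → q *ₚ ((t- d) *ₚ p) ≈ₚ (t- d) *ₚ (q *ₚ p)
*ₚ-linear-comm d []      p k = sym (trans (coeff-linear d [] k)
                                      (cong₂ ℤ._+_ (ℤP.*-zeroʳ (- d)) (coeff-0∷[] k)))
*ₚ-linear-comm d (c ∷ q) p k = begin
  coeff ((c ∷ q) *ₚ ((t- d) *ₚ p)) k
    ≡⟨ coeff-∷-* c q ((t- d) *ₚ p) k ⟩
  c ℤ.* coeff ((t- d) *ₚ p) k ℤ.+ coeff (0ℤ ∷ q *ₚ ((t- d) *ₚ p)) k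
    ≡⟨ cong₂ (λ i j → c ℤ.* i ℤ.+ j) (coeff-linear d p k) (shift k) ⟩
  c ℤ.* (- d ℤ.* coeff p k ℤ.+ coeff (0ℤ ∷ p) k) ℤ.+
    (- d ℤ.* coeff (0ℤ ∷ q *ₚ p) k ℤ.+ coeff (0ℤ ∷ 0ℤ ∷ q *ₚ p) k)
    ≡⟨ lemma c d (coeff p k) (coeff (0ℤ ∷ p) k) (coeff (0ℤ ∷ q *ₚ p) k) (coeff (0ℤ ∷ 0ℤ ∷ q *ₚ p) k) ⟩
  - d ℤ.* (c ℤ.* coeff p k ℤ.+ coeff (0ℤ ∷ q *ₚ p) k) ℤ.+
    (c ℤ.* coeff (0ℤ ∷ p) k ℤ.+ coeff (0ℤ ∷ 0ℤ ∷ q *ₚ p) k)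
    ≡⟨ cong₂ (λ i j → - d ℤ.* i ℤ.+ j) (coeff-∷-* c q p k) (shift-product k) ⟨
  - d ℤ.* coeff ((c ∷ q) *ₚ p) k ℤ.+ coeff (0ℤ ∷ (c ∷ q) *ₚ p) k
    ≡⟨ coeff-linear d ((c ∷ q) *ₚ p) k ⟨
  coeff ((t- d) *ₚ ((c ∷ q) *ₚ p)) k ∎
  where
  open ≡-Reasoning
  lemma : ∀ c d u v w z → c ℤ.* (- d ℤ.* u ℤ.+ v) ℤ.+ (- d ℤ.* w ℤ.+ z) ≡
                          - d ℤ.* (c ℤ.* u ℤ.+ w) ℤ.+ (c ℤ.* v ℤ.+ z)
  lemma = solve-∀

  shift : ∀ k → coeff (0ℤ ∷ q *ₚ ((t- d) *ₚ p)) k ≡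
                - d ℤ.* coeff (0ℤ ∷ q *ₚ p) k ℤ.+ coeff (0ℤ ∷ 0ℤ ∷ q *ₚ p) k
  shift zero    = sym (trans (ℤP.+-identityʳ _) (ℤP.*-zeroʳ (- d)))
  shift (suc k) = trans (*ₚ-linear-comm d q p k) (coeff-linear d (q *ₚ p) k)

  shift-product : ∀ k → coeff (0ℤ ∷ (c ∷ q) *ₚ p) k ≡
                        c ℤ.* coeff (0ℤ ∷ p) k ℤ.+ coeff (0ℤ ∷ 0ℤ ∷ q *ₚ p) k
  shift-product zero    = sym (trans (ℤP.+-identityʳ _) (ℤP.*-zeroʳ c))
  shift-product (suc k) = coeff-∷-* c q p k

-- Monic polynomials and cancellation of linear factors

record Monic (n : ℕ) (p : Poly) : Set where
  field
    leading : coeff p n ≡ 1ℤ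
    above   : ∀ {k} → n < k → coeff p k ≡ 0ℤ
open Monic

Monic-≈ₚ : ∀ {n p q} → p ≈ₚ q → Monic n p → Monic n q
Monic-≈ₚ p≈q monic .leading   = trans (sym (p≈q _)) (leading monic)
Monic-≈ₚ p≈q monic .above n<k = trans (sym (p≈q _)) (above monic n<k)

monic₀ : ∀ {p} → Monic 0 p → p ≈ₚ 1ℤ ∷ []
monic₀ monic zero    = leading monic
monic₀ monic (suc k) = above monic (s≤s z≤n)

monic₁ : ∀ {p} → Monic 1 p → p ≈ₚ t- (- coeff p 0)
monic₁ {p} monic zero          = sym (ℤP.neg-involutive (coeff p 0))
monic₁ {p} monic (suc zero)    = leading monic
monic₁ {p} monic (suc (suc k)) = above monic (s≤s (s≤s z≤n))

coeff-above-length : ∀ p k → length p ℕ.≤ k → coeff p k ≡ 0ℤ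
coeff-above-length []      k       _         = refl
coeff-above-length (c ∷ p) (suc k) (s≤s l≤k) = coeff-above-length p k l≤k

-- Above the leading coefficient q_k = d q_{k+1}, and q_k vanishes for large k.
Monic-linear⁻ : ∀ {m} d q → Monic (suc m) ((t- d) *ₚ q) → Monic m q
Monic-linear⁻ {m} d q monic = record { leading = leading-q ; above = λ {k} → above-q (length q) k (ℕP.m≤n+m _ _) }
  where
  recurrence : ∀ k → coeff q k ≡ coeff ((t- d) *ₚ q) (suc k) ℤ.+ d ℤ.* coeff q (suc k)
  recurrence k rewrite coeff-linear d q (suc k) = lemma d (coeff q k) (coeff q (suc k))
    where
    lemma : ∀ d u v → u ≡ (- d ℤ.* v ℤ.+ u) ℤ.+ d ℤ.* v
    lemma = solve-∀

  -- `n` bounds the distance from `k` to `length q`, from where on `coeff` is 0 by default; the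
  -- downward induction on `k` is thus structural in `n`.
  above-q : ∀ n k → length q ℕ.≤ k ℕ.+ n → m < k → coeff q k ≡ 0ℤ
  above-q zero    k l≤ m<k = coeff-above-length q k (subst (length q ℕ.≤_) (ℕP.+-identityʳ k) l≤)
  above-q (suc n) k l≤ m<k
    rewrite recurrence k | above monic (s≤s m<k)
          | above-q n (suc k) (subst (length q ℕ.≤_) (ℕP.+-suc k n) l≤) (ℕP.m<n⇒m<1+n m<k)
          = trans (ℤP.+-identityˡ _) (ℤP.*-zeroʳ d)

  leading-q : coeff q m ≡ 1ℤ
  leading-q rewrite recurrence m | leading monic
                  | above-q (length q) (suc m) (ℕP.m≤n+m _ _) ℕP.≤-refl
                  = cong (ℤ._+_ 1ℤ) (ℤP.*-zeroʳ d)

-- The linear factors are stripped one at a time. With `m = 1` this shows that the quotient of two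
-- characteristic polynomials of adjacent degrees is linear and monic.
Monic-∏⁻ : ∀ {n m} (ds : Vec ℕ n) q → Monic (n ℕ.+ m) (q *ₚ ∏[t- ds ]) → Monic m q
Monic-∏⁻ []       q monic = Monic-≈ₚ (*ₚ-identityʳ q) monic
  where
  *ₚ-identityʳ : ∀ q → q *ₚ (1ℤ ∷ []) ≈ₚ q
  *ₚ-identityʳ []      k       = refl
  *ₚ-identityʳ (c ∷ q) zero    = trans (ℤP.+-identityʳ _) (ℤP.*-identityʳ c)
  *ₚ-identityʳ (c ∷ q) (suc k) = *ₚ-identityʳ q k
Monic-∏⁻ (d ∷ ds) q monic =
  Monic-∏⁻ ds q (Monic-linear⁻ (+ d) (q *ₚ ∏[t- ds ]) (Monic-≈ₚ (*ₚ-linear-comm (+ d) q ∏[t- ds ]) monic))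

-- Evaluation of polynomials

eval : Poly → ℤ → ℤ
eval []      z = 0ℤ
eval (c ∷ p) z = c ℤ.+ z ℤ.* eval p z

eval-≈ₚ : ∀ p q z → p ≈ₚ q → eval p z ≡ eval q z
eval-≈ₚ []      []      z p≈q = refl
eval-≈ₚ []      (d ∷ q) z p≈q rewrite sym (p≈q 0) | sym (eval-≈ₚ [] q z (p≈q ∘ suc)) =
  sym (trans (ℤP.+-identityˡ _) (ℤP.*-zeroʳ z))
eval-≈ₚ (c ∷ p) []      z p≈q rewrite p≈q 0 | eval-≈ₚ p [] z (p≈q ∘ suc) =
  trans (ℤP.+-identityˡ _) (ℤP.*-zeroʳ z)
eval-≈ₚ (c ∷ p) (d ∷ q) z p≈q =
  cong₂ (λ i j → i ℤ.+ z ℤ.* j) (p≈q 0) (eval-≈ₚ p q z (p≈q ∘ suc))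

eval-+ : ∀ p q z → eval (p +ₚ q) z ≡ eval p z ℤ.+ eval q z
eval-+ []      q       z = sym (ℤP.+-identityˡ _)
eval-+ (c ∷ p) []      z = sym (ℤP.+-identityʳ _)
eval-+ (c ∷ p) (d ∷ q) z rewrite eval-+ p q z = lemma c d z (eval p z) (eval q z)
  where
  lemma : ∀ c d z u v → (c ℤ.+ d) ℤ.+ z ℤ.* (u ℤ.+ v) ≡ (c ℤ.+ z ℤ.* u) ℤ.+ (d ℤ.+ z ℤ.* v)
  lemma = solve-∀

eval-scale : ∀ c p z → eval (map (c ℤ.*_) p) z ≡ c ℤ.* eval p z
eval-scale c []      z = sym (ℤP.*-zeroʳ c)
eval-scale c (d ∷ p) z rewrite eval-scale c p z = lemma c d z (eval p z)
  where
  lemma : ∀ c d z u → c ℤ.* d ℤ.+ z ℤ.* (c ℤ.* u) ≡ c ℤ.* (d ℤ.+ z ℤ.* u)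
  lemma = solve-∀

eval-* : ∀ p q z → eval (p *ₚ q) z ≡ eval p z ℤ.* eval q z
eval-* []      q z = refl
eval-* (c ∷ p) q z
  rewrite eval-+ (map (c ℤ.*_) q) (0ℤ ∷ p *ₚ q) z | eval-scale c q z | eval-* p q z =
  lemma c z (eval p z) (eval q z)
  where
  lemma : ∀ c z u v → c ℤ.* v ℤ.+ (0ℤ ℤ.+ z ℤ.* (u ℤ.* v)) ≡ (c ℤ.+ z ℤ.* u) ℤ.* v
  lemma = solve-∀

eval-linear : ∀ d → eval (t- d) d ≡ 0ℤ
eval-linear = lemma
  where
  lemma : ∀ d → - d ℤ.+ d ℤ.* (1ℤ ℤ.+ d ℤ.* 0ℤ) ≡ 0ℤ
  lemma = solve-∀

eval-monomial : ∀ c k z → eval (monomial c k) z ≡ c ℤ.* z ℤ.^ k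
eval-monomial c zero    z = lemma c z
  where
  lemma : ∀ c z → c ℤ.+ z ℤ.* 0ℤ ≡ c ℤ.* 1ℤ
  lemma = solve-∀
eval-monomial c (suc k) z rewrite eval-monomial c k z = lemma c z (z ℤ.^ k)
  where
  lemma : ∀ c z u → 0ℤ ℤ.+ z ℤ.* (c ℤ.* u) ≡ c ℤ.* (z ℤ.* u)
  lemma = solve-∀

-- The characteristic polynomial

private
  nonneg-* : ∀ {i j} → 0ℤ ℤ.≤ i → 0ℤ ℤ.≤ j → 0ℤ ℤ.≤ i ℤ.* j
  nonneg-* {i} {j} 0≤i 0≤j =
    subst (ℤ._≤ i ℤ.* j) (ℤP.*-zeroʳ i) (ℤP.*-monoˡ-≤-nonNeg i {{ℤ.nonNegative 0≤i}} 0≤j)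

  nonneg-^ : ∀ {i} → 0ℤ ℤ.≤ i → ∀ n → 0ℤ ℤ.≤ i ℤ.^ n
  nonneg-^ 0≤i zero    = +≤+ z≤n
  nonneg-^ 0≤i (suc n) = nonneg-* 0≤i (nonneg-^ 0≤i n)

  neg-^ : ∀ i n → (- i) ℤ.^ n ≡ sgn n ℤ.* i ℤ.^ n
  neg-^ i zero    = refl
  neg-^ i (suc n) rewrite neg-^ i n = lemma i (sgn n) (i ℤ.^ n)
    where
    lemma : ∀ i s u → - i ℤ.* (s ℤ.* u) ≡ -1ℤ ℤ.* s ℤ.* (i ℤ.* u)
    lemma = solve-∀

coeff-monomial : ∀ c k → coeff (monomial c k) k ≡ c
coeff-monomial c zero    = refl
coeff-monomial c (suc k) = coeff-monomial c k

coeff-monomial-≢ : ∀ c {k l} → l ≢ k → coeff (monomial c k) l ≡ 0ℤ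
coeff-monomial-≢ c {zero}  {zero}  l≢k = contradiction refl l≢k
coeff-monomial-≢ c {zero}  {suc l} l≢k = refl
coeff-monomial-≢ c {suc k} {zero}  l≢k = refl
coeff-monomial-≢ c {suc k} {suc l} l≢k = coeff-monomial-≢ c (l≢k ∘ cong suc)

module _ (P : RankedPoset) where
  open RankedPoset P renaming (_<_ to infix 4 _≺_)

  private
    term : Carrier → Poly
    term x = monomial (μ 0̂ x) (rank ∸ rk x)

  coeff-χ : ∀ k → coeff χ k ≡ ∑ elements (λ x → coeff (term x) k)
  coeff-χ k = go elements
    where
    go : ∀ xs → coeff (foldr _+ₚ_ [] (map term xs)) k ≡ ∑ xs (λ x → coeff (term x) k)
    go []       = refl
    go (x ∷ xs) = trans (coeff-+ (term x) _ k) (cong (ℤ._+_ (coeff (term x) k)) (go xs))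

  eval-χ : ∀ z → eval χ z ≡ ∑ elements (λ x → μ 0̂ x ℤ.* z ℤ.^ (rank ∸ rk x))
  eval-χ z = go elements
    where
    go : ∀ xs → eval (foldr _+ₚ_ [] (map term xs)) z ≡ ∑ xs (λ x → μ 0̂ x ℤ.* z ℤ.^ (rank ∸ rk x))
    go []       = refl
    go (x ∷ xs) = trans (eval-+ (term x) _ z) (cong₂ ℤ._+_ (eval-monomial (μ 0̂ x) (rank ∸ rk x) z) (go xs))

  -- Only elements of rank 0 contribute to the top coefficient, so `0̂` alone does, with
  -- `μ 0̂ 0̂ = 1`.
  χ-monic : Monic rank χ
  χ-monic .leading = begin
    coeff χ rank                                 ≡⟨ coeff-χ rank ⟩
    ∑ elements (λ x → coeff (term x) rank)       ≡⟨ ∑-single unique (complete 0̂) at-≢0̂ ⟩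
    coeff (monomial (μ 0̂ 0̂) (rank ∸ rk 0̂)) rank  ≡⟨ cong (λ r → coeff (monomial (μ 0̂ 0̂) (rank ∸ r)) rank) (rk-0̂ P) ⟩
    coeff (monomial (μ 0̂ 0̂) rank) rank           ≡⟨ coeff-monomial (μ 0̂ 0̂) rank ⟩
    μ 0̂ 0̂                                        ≡⟨ μ-refl finitePoset 0̂ ⟩
    1ℤ                                           ∎
    where
    open ≡-Reasoning
    full⇒≡0̂ : ∀ {x} → rank ≡ rank ∸ rk x → x ≡ 0̂
    full⇒≡0̂ {x} eq = rk≡0⇒≡0̂ P (begin
      rk x                    ≡⟨ ℕP.m∸[m∸n]≡n (rk≤rank P x) ⟨
      rank ∸ (rank ∸ rk x)    ≡⟨ cong (rank ∸_) eq ⟨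
      rank ∸ rank             ≡⟨ ℕP.n∸n≡0 rank ⟩
      0                       ∎)

    at-≢0̂ : ∀ x → x ≢ 0̂ → coeff (term x) rank ≡ 0ℤ
    at-≢0̂ x x≢0̂ = coeff-monomial-≢ (μ 0̂ x) (x≢0̂ ∘ full⇒≡0̂)

  χ-monic .above {k} rank<k = trans (coeff-χ k) (∑-zero too-high elements)
    where
    too-high : ∀ x → coeff (term x) k ≡ 0ℤ
    too-high x = coeff-monomial-≢ (μ 0̂ x) {rank ∸ rk x} λ where
      refl → ℕP.<⇒≱ rank<k (ℕP.m∸n≤m rank (rk x))

  -- At z ≤ 0 the terms of χ all have the sign of (-1)^rank or vanish, and
  -- those of the elements of top rank do not vanish.
  χ-root-pos : LocallyGeometric P → ∀ z → eval χ z ≡ 0ℤ → 0ℤ ℤ.< z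
  χ-root-pos locallyGeometric z χz≡0 = ℤP.≰⇒> z≰0
    where
    -- This is the term of `x` in `sgn rank ℤ.* eval χ z`: the sign splits as `sgn (rk x)` times
    -- `sgn (rank ∸ rk x)`, and the second factor turns the power of `z` into one of `- z`.
    value-at : Carrier → ℤ
    value-at x = sgn (rk x) ℤ.* μ 0̂ x ℤ.* (- z) ℤ.^ (rank ∸ rk x)

    ∑-value-at : ∑ elements value-at ≡ 0ℤ
    ∑-value-at = begin
      ∑ elements value-at                                                     ≡⟨ ∑-cong signed elements ⟩
      ∑ elements (λ x → sgn rank ℤ.* (μ 0̂ x ℤ.* z ℤ.^ (rank ∸ rk x)))         ≡⟨ ∑-* (sgn rank) _ elements ⟩
      sgn rank ℤ.* ∑ elements (λ x → μ 0̂ x ℤ.* z ℤ.^ (rank ∸ rk x))           ≡⟨ cong (sgn rank ℤ.*_) (eval-χ z) ⟨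
      sgn rank ℤ.* eval χ z                                                   ≡⟨ cong (sgn rank ℤ.*_) χz≡0 ⟩
      sgn rank ℤ.* 0ℤ                                                         ≡⟨ ℤP.*-zeroʳ (sgn rank) ⟩
      0ℤ                                                                      ∎
      where
      open ≡-Reasoning
      lemma : ∀ a b c d → a ℤ.* b ℤ.* (c ℤ.* d) ≡ a ℤ.* c ℤ.* (b ℤ.* d)
      lemma = solve-∀

      signed : ∀ x → value-at x ≡ sgn rank ℤ.* (μ 0̂ x ℤ.* z ℤ.^ (rank ∸ rk x))
      signed x = begin
        sgn (rk x) ℤ.* μ 0̂ x ℤ.* (- z) ℤ.^ (rank ∸ rk x)
          ≡⟨ cong (sgn (rk x) ℤ.* μ 0̂ x ℤ.*_) (neg-^ z (rank ∸ rk x)) ⟩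
        sgn (rk x) ℤ.* μ 0̂ x ℤ.* (sgn (rank ∸ rk x) ℤ.* z ℤ.^ (rank ∸ rk x))
          ≡⟨ lemma (sgn (rk x)) (μ 0̂ x) (sgn (rank ∸ rk x)) _ ⟩
        sgn (rk x) ℤ.* sgn (rank ∸ rk x) ℤ.* (μ 0̂ x ℤ.* z ℤ.^ (rank ∸ rk x))
          ≡⟨ cong (ℤ._* (μ 0̂ x ℤ.* z ℤ.^ (rank ∸ rk x))) (ℤP.^-distribˡ-+-* -1ℤ (rk x) (rank ∸ rk x)) ⟨
        sgn (rk x ℕ.+ (rank ∸ rk x)) ℤ.* (μ 0̂ x ℤ.* z ℤ.^ (rank ∸ rk x))
          ≡⟨ cong (λ n → sgn n ℤ.* (μ 0̂ x ℤ.* z ℤ.^ (rank ∸ rk x))) (ℕP.m+[n∸m]≡n (rk≤rank P x)) ⟩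
        sgn rank ℤ.* (μ 0̂ x ℤ.* z ℤ.^ (rank ∸ rk x)) ∎

    z≰0 : ¬ (z ℤ.≤ 0ℤ)
    z≰0 z≤0 with rank-attained P
    ... | x , rk≡rank = ℤP.<-irrefl (sym ∑-value-at) (∑-pos nonneg (complete x) pos)
      where
      nonneg : ∀ x → 0ℤ ℤ.≤ value-at x
      nonneg x = nonneg-* (ℤP.<⇒≤ (sgn-μ-pos P locallyGeometric x))
                          (nonneg-^ (ℤP.neg-mono-≤ z≤0) (rank ∸ rk x))

      -- At top rank the exponent is 0, so the power is 1 even for `z = 0`.
      pos : 0ℤ ℤ.< value-at x
      pos rewrite trans (cong (rank ∸_) rk≡rank) (ℕP.n∸n≡0 rank)
                | ℤP.*-identityʳ (sgn (rk x) ℤ.* μ 0̂ x) = sgn-μ-pos P locallyGeometric x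

-- Splitting the characteristic polynomial along a derivation

theorem1p2 : (P : RankedPoset) (divisional : Divisional P) → RankDropsByOne divisional →
    ∃ λ (ds : Vec ℕ (RankedPoset.rank P)) → All (λ d → 0 < d) ds × RankedPoset.χ P ≈ₚ ∏[t- ds ]
theorem1p2 P (trivial ≡0̂) _ = roots rank≡0 (χ-monic P)
  where
  open RankedPoset P using (0̂; rk; rank; χ)

  rank≡0 : rank ≡ 0
  rank≡0 with rank-attained P
  ... | x , rk≡rank = trans (sym rk≡rank) (trans (cong rk (≡0̂ x)) (rk-0̂ P))

  -- Replacing `rank` by a variable allows matching on the equation, so that the length of the
  -- vector computes.
  roots : ∀ {n} → n ≡ 0 → Monic n χ →
          ∃ λ (ds : Vec ℕ n) → All (λ d → 0 < d) ds × χ ≈ₚ ∏[t- ds ]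
  roots refl monic = [] , [] , monic₀ monic
theorem1p2 P (step locallyGeometric a _ divisional″ (q , χ≈q*χ″)) (rank≡ , rankDrops)
  with theorem1p2 (P≥ P a) divisional″ rankDrops
... | ds , ds>0 , χ″≈∏ = roots rank≡ (- coeff q 0) refl
  where
  open RankedPoset P using (rank; χ)

  χ≈q*∏ : χ ≈ₚ q *ₚ ∏[t- ds ]
  χ≈q*∏ k = trans (χ≈q*χ″ k) (*ₚ-congˡ q χ″≈∏ k)

  -- `χ` is monic of degree `rank`, which is one more than the length of `ds`, so degree 1 is left
  -- for `q`.
  q-monic : Monic 1 q
  q-monic = Monic-∏⁻ ds q
    (Monic-≈ₚ χ≈q*∏ (subst (λ n → Monic n χ) (trans rank≡ (ℕP.+-comm 1 _)) (χ-monic P)))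

  χ≈linear*∏ : χ ≈ₚ (t- (- coeff q 0)) *ₚ ∏[t- ds ]
  χ≈linear*∏ k = trans (χ≈q*∏ k) (*ₚ-congʳ q (t- (- coeff q 0)) ∏[t- ds ] (monic₁ q-monic) k)

  root-pos : 0ℤ ℤ.< - coeff q 0
  root-pos = χ-root-pos P locallyGeometric d
    (trans (eval-≈ₚ χ ((t- d) *ₚ ∏[t- ds ]) d χ≈linear*∏)
      (trans (eval-* (t- d) ∏[t- ds ] d) (cong (ℤ._* eval ∏[t- ds ] d) (eval-linear d))))
    where
    d : ℤ
    d = - coeff q 0

  -- The root is also replaced by a variable, to be split by sign; `root-pos` excludes every case
  -- but `+ suc d`.
  roots : ∀ {n} → n ≡ suc (RankedPoset.rank (P≥ P a)) → ∀ d → d ≡ - coeff q 0 →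
          ∃ λ (ds : Vec ℕ n) → All (λ d → 0 < d) ds × χ ≈ₚ ∏[t- ds ]
  roots refl (+ suc d)  d≡ =
    suc d ∷ ds , s≤s z≤n ∷ ds>0 , subst (λ i → χ ≈ₚ (t- i) *ₚ ∏[t- ds ]) (sym d≡) χ≈linear*∏
  roots refl (+ zero)   d≡ = contradiction (subst (0ℤ ℤ.<_) (sym d≡) root-pos) λ { (+<+ ()) }
  roots refl (-[1+ _ ]) d≡ = contradiction (subst (0ℤ ℤ.<_) (sym d≡) root-pos) λ ()
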